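{- Suppose $p,q,r,s\in\mathbf{Z}_{>0}$ and $M=\left[\begin{array}{cc} p&q\\ r&s\end{array}\right]\in\mathrm{PGL}_2(\mathbf{Z})$ (so $ps-qr=\pm1$). Then $$\alpha(M)=\left[\begin{array}{cc} \mathrm{con}\left(\frac{2p+q}{2r+s}\right)-\mathrm{con}\left(\frac{p+q}{r+s}\right) & 2\,\mathrm{con}\left(\frac{p+q}{r+s}\right)-\mathrm{con}\left(\frac{2p+q}{2r+s}\right)\\[2mm] \mathrm{con}\left(\frac{2r+s}{2p+q}\right)-\mathrm{con}\left(\frac{r+s}{p+q}\right) & 2\,\mathrm{con}\left(\frac{r+s}{p+q}\right)-\mathrm{con}\left(\frac{2r+s}{2p+q}\right)\end{array}\right].$$
   Context: The conumerator $\mathrm{con}:\mathbf{Q}_{>0}\to\mathbf{Z}_{>0}$ is the unique function with $\mathrm{con}(1)=1$ satisfying, for all $x\in\mathbf{Q}_{>0}$, $\mathrm{con}(1+x)=\mathrm{con}(x)+\mathrm{con}(1/x)$ and $\mathrm{con}\left(\frac{1}{1+x}\right)=\mathrm{con}(x)$. Square brackets denote the image in $\mathrm{PGL}_2(\mathbf{Z})=\mathrm{GL}_2(\mathbf{Z})/\{\pm I\}$ of a matrix in $\mathrm{GL}_2(\mathbf{Z})$; the class of $\left(\begin{smallmatrix}a&b\\c&d\end{smallmatrix}\right)$ is identified with the Möbius transformation $x\mapsto\frac{ax+b}{cx+d}$. The group $\mathrm{PGL}_2(\mathbf{Z})$ is generated by $V:x\mapsto -x$, $K:x\mapsto 1-x$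 and $U:x\mapsto 1/x$. The map $\alpha$ is Dyer's (involutive) outer automorphism of $\mathrm{PGL}_2(\mathbf{Z})$, the automorphism determined by $\alpha(V)=UV$ (i.e. $x\mapsto -1/x$), $\alpha(K)=K$, $\alpha(U)=U$. -}

module Defs where

open import Algebra.Bundles using (Group)
open import Algebra.Morphism.Structures using (module GroupMorphisms)
open import Data.Integer.Base as ℤ using (ℤ; +_; 0ℤ; 1ℤ; -1ℤ)
open import Data.Integer.Properties as ℤ using (neg-involutive)
open import Data.Integer.Tactic.RingSolver using (solve-∀)
open import Data.Nat.Base as ℕ using (ℕ; suc)
open import Data.Nat.Properties as ℕ using (m*n≢0)
open import Data.Product.Base using (_,_)
open import Data.Rational.Base as ℚ using (ℚ; 1ℚ)
open import Data.Rational.Properties as ℚ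
  using (normalize-pos; pos+pos⇒pos; pos⇒nonZero; 1/pos⇒pos)
open import Data.Sum.Base using (_⊎_; inj₁; inj₂)
open import Level using (0ℓ)
open import Relation.Binary.Definitions using (Reflexive; Symmetric; Transitive)
open import Relation.Binary.PropositionalEquality
  using (_≡_; refl; sym; trans; cong; cong₂)

record ℕ⁺ : Set where
  constructor mkℕ⁺
  field
    value        : ℕ
    .{{nonZero}} : ℕ.NonZero value

record ℚ⁺ : Set where
  constructor mkℚ⁺
  field
    value         : ℚ
    .{{positive}} : ℚ.Positive value

infixl 6 _+ℕ⁺_ _+ℚ⁺_
infixl 7 _*ℕ⁺_ _/⁺_

toℤ : ℕ⁺ → ℤ
toℤ n = + ℕ⁺.value n

1ℕ⁺ 2ℕ⁺ : ℕ⁺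
1ℕ⁺ = mkℕ⁺ 1
2ℕ⁺ = mkℕ⁺ 2

+-nonZero : ∀ m n → .{{ℕ.NonZero m}} → ℕ.NonZero (m ℕ.+ n)
+-nonZero (suc _) _ = _

_+ℕ⁺_ : ℕ⁺ → ℕ⁺ → ℕ⁺
mkℕ⁺ m +ℕ⁺ mkℕ⁺ n = mkℕ⁺ (m ℕ.+ n) {{+-nonZero m n}}

_*ℕ⁺_ : ℕ⁺ → ℕ⁺ → ℕ⁺
mkℕ⁺ m *ℕ⁺ mkℕ⁺ n = mkℕ⁺ (m ℕ.* n) {{m*n≢0 m n}}

_/⁺_ : ℕ⁺ → ℕ⁺ → ℚ⁺
mkℕ⁺ m /⁺ mkℕ⁺ n = mkℚ⁺ (+ m ℚ./ n) {{normalize-pos m n}}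

1ℚ⁺ : ℚ⁺
1ℚ⁺ = mkℚ⁺ 1ℚ

_+ℚ⁺_ : ℚ⁺ → ℚ⁺ → ℚ⁺
mkℚ⁺ x +ℚ⁺ mkℚ⁺ y = mkℚ⁺ (x ℚ.+ y) {{pos+pos⇒pos x y}}

1/⁺_ : ℚ⁺ → ℚ⁺
1/⁺ mkℚ⁺ x = mkℚ⁺ ((ℚ.1/ x) {{pos⇒nonZero x}}) {{1/pos⇒pos x}}

record IsConumerator (con : ℚ⁺ → ℕ⁺) : Set where
  field
    con-1       : con 1ℚ⁺ ≡ 1ℕ⁺
    con-1+x     : ∀ x → con (1ℚ⁺ +ℚ⁺ x) ≡ con x +ℕ⁺ con (1/⁺ x)
    con-1/[1+x] : ∀ x → con (1/⁺ (1ℚ⁺ +ℚ⁺ x)) ≡ con x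

-- mat a b c d has rows (a b) and (c d).
record Mat₂ : Set where
  constructor mat
  field
    a b c d : ℤ

mat-cong : ∀ {a a′ b b′ c c′ d d′} → a ≡ a′ → b ≡ b′ → c ≡ c′ → d ≡ d′ →
           mat a b c d ≡ mat a′ b′ c′ d′
mat-cong refl refl refl refl = refl

infixl 7 _*ᴹ_
infix  8 -ᴹ_

_*ᴹ_ : Mat₂ → Mat₂ → Mat₂
mat a b c d *ᴹ mat a′ b′ c′ d′ =
  mat (a ℤ.* a′ ℤ.+ b ℤ.* c′) (a ℤ.* b′ ℤ.+ b ℤ.* d′)
      (c ℤ.* a′ ℤ.+ d ℤ.* c′) (c ℤ.* b′ ℤ.+ d ℤ.* d′)

-ᴹ_ : Mat₂ → Mat₂
-ᴹ mat a b c d = mat (ℤ.- a) (ℤ.- b) (ℤ.- c) (ℤ.- d)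

Iᴹ : Mat₂
Iᴹ = mat 1ℤ 0ℤ 0ℤ 1ℤ

adj : Mat₂ → Mat₂
adj (mat a b c d) = mat d (ℤ.- b) (ℤ.- c) a

det : Mat₂ → ℤ
det (mat a b c d) = a ℤ.* d ℤ.- b ℤ.* c

Unimodular : Mat₂ → Set
Unimodular A = det A ≡ 1ℤ ⊎ det A ≡ -1ℤ

det-*ᴹ : ∀ A B → det (A *ᴹ B) ≡ det A ℤ.* det B
det-*ᴹ (mat a b c d) (mat a′ b′ c′ d′) = lemma a b c d a′ b′ c′ d′
  where
  lemma : ∀ a b c d a′ b′ c′ d′ →
    (a ℤ.* a′ ℤ.+ b ℤ.* c′) ℤ.* (c ℤ.* b′ ℤ.+ d ℤ.* d′) ℤ.-
    (a ℤ.* b′ ℤ.+ b ℤ.* d′) ℤ.* (c ℤ.* a′ ℤ.+ d ℤ.* c′) ≡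
    (a ℤ.* d ℤ.- b ℤ.* c) ℤ.* (a′ ℤ.* d′ ℤ.- b′ ℤ.* c′)
  lemma = solve-∀

det-adj : ∀ A → det (adj A) ≡ det A
det-adj (mat a b c d) = lemma a b c d
  where
  lemma : ∀ a b c d → d ℤ.* a ℤ.- (ℤ.- b) ℤ.* (ℤ.- c) ≡ a ℤ.* d ℤ.- b ℤ.* c
  lemma = solve-∀

*ᴹ-unimodular : ∀ A B → Unimodular A → Unimodular B → Unimodular (A *ᴹ B)
*ᴹ-unimodular A B (inj₁ p) (inj₁ q) = inj₁ (trans (det-*ᴹ A B) (cong₂ ℤ._*_ p q))
*ᴹ-unimodular A B (inj₁ p) (inj₂ q) = inj₂ (trans (det-*ᴹ A B) (cong₂ ℤ._*_ p q))
*ᴹ-unimodular A B (inj₂ p) (inj₁ q) = inj₂ (trans (det-*ᴹ A B) (cong₂ ℤ._*_ p q))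
*ᴹ-unimodular A B (inj₂ p) (inj₂ q) = inj₁ (trans (det-*ᴹ A B) (cong₂ ℤ._*_ p q))

adj-unimodular : ∀ A → Unimodular A → Unimodular (adj A)
adj-unimodular A (inj₁ p) = inj₁ (trans (det-adj A) p)
adj-unimodular A (inj₂ p) = inj₂ (trans (det-adj A) p)

*ᴹ-assoc : ∀ A B C → (A *ᴹ B) *ᴹ C ≡ A *ᴹ (B *ᴹ C)
*ᴹ-assoc (mat a b c d) (mat a′ b′ c′ d′) (mat x y z w) =
  mat-cong (entry a b a′ b′ c′ d′ x z) (entry a b a′ b′ c′ d′ y w)
           (entry c d a′ b′ c′ d′ x z) (entry c d a′ b′ c′ d′ y w)
  where
  entry : ∀ a b a′ b′ c′ d′ x z →
    (a ℤ.* a′ ℤ.+ b ℤ.* c′) ℤ.* x ℤ.+ (a ℤ.* b′ ℤ.+ b ℤ.* d′) ℤ.* z ≡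
    a ℤ.* (a′ ℤ.* x ℤ.+ b′ ℤ.* z) ℤ.+ b ℤ.* (c′ ℤ.* x ℤ.+ d′ ℤ.* z)
  entry = solve-∀

*ᴹ-identityˡ : ∀ A → Iᴹ *ᴹ A ≡ A
*ᴹ-identityˡ (mat a b c d) = mat-cong (top a c) (top b d) (bottom a c) (bottom b d)
  where
  top : ∀ x y → 1ℤ ℤ.* x ℤ.+ 0ℤ ℤ.* y ≡ x
  top = solve-∀
  bottom : ∀ x y → 0ℤ ℤ.* x ℤ.+ 1ℤ ℤ.* y ≡ y
  bottom = solve-∀

*ᴹ-identityʳ : ∀ A → A *ᴹ Iᴹ ≡ A
*ᴹ-identityʳ (mat a b c d) = mat-cong (left a b) (right a b) (left c d) (right c d)
  where
  left : ∀ x y → x ℤ.* 1ℤ ℤ.+ y ℤ.* 0ℤ ≡ x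
  left = solve-∀
  right : ∀ x y → x ℤ.* 0ℤ ℤ.+ y ℤ.* 1ℤ ≡ y
  right = solve-∀

scalar : ℤ → Mat₂
scalar k = mat k 0ℤ 0ℤ k

*ᴹ-adjˡ : ∀ A → adj A *ᴹ A ≡ scalar (det A)
*ᴹ-adjˡ (mat a b c d) = mat-cong (p a b c d) (q b d) (r a c) (s a b c d)
  where
  p : ∀ a b c d → d ℤ.* a ℤ.+ (ℤ.- b) ℤ.* c ≡ a ℤ.* d ℤ.- b ℤ.* c
  p = solve-∀
  q : ∀ b d → d ℤ.* b ℤ.+ (ℤ.- b) ℤ.* d ≡ 0ℤ
  q = solve-∀
  r : ∀ a c → (ℤ.- c) ℤ.* a ℤ.+ a ℤ.* c ≡ 0ℤ
  r = solve-∀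
  s : ∀ a b c d → (ℤ.- c) ℤ.* b ℤ.+ a ℤ.* d ≡ a ℤ.* d ℤ.- b ℤ.* c
  s = solve-∀

*ᴹ-adjʳ : ∀ A → A *ᴹ adj A ≡ scalar (det A)
*ᴹ-adjʳ (mat a b c d) = mat-cong (p a b c d) (q a b) (r c d) (s a b c d)
  where
  p : ∀ a b c d → a ℤ.* d ℤ.+ b ℤ.* (ℤ.- c) ≡ a ℤ.* d ℤ.- b ℤ.* c
  p = solve-∀
  q : ∀ a b → a ℤ.* (ℤ.- b) ℤ.+ b ℤ.* a ≡ 0ℤ
  q = solve-∀
  r : ∀ c d → c ℤ.* d ℤ.+ d ℤ.* (ℤ.- c) ≡ 0ℤ
  r = solve-∀
  s : ∀ a b c d → c ℤ.* (ℤ.- b) ℤ.+ d ℤ.* a ≡ a ℤ.* d ℤ.- b ℤ.* c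
  s = solve-∀

-ᴹ-involutive : ∀ A → -ᴹ (-ᴹ A) ≡ A
-ᴹ-involutive (mat a b c d) =
  mat-cong (neg-involutive a) (neg-involutive b) (neg-involutive c) (neg-involutive d)

-ᴹ-*ˡ : ∀ A B → (-ᴹ A) *ᴹ B ≡ -ᴹ (A *ᴹ B)
-ᴹ-*ˡ (mat a b c d) (mat a′ b′ c′ d′) =
  mat-cong (entry a b a′ c′) (entry a b b′ d′) (entry c d a′ c′) (entry c d b′ d′)
  where
  entry : ∀ a b x y → (ℤ.- a) ℤ.* x ℤ.+ (ℤ.- b) ℤ.* y ≡ ℤ.- (a ℤ.* x ℤ.+ b ℤ.* y)
  entry = solve-∀

-ᴹ-*ʳ : ∀ A B → A *ᴹ (-ᴹ B) ≡ -ᴹ (A *ᴹ B)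
-ᴹ-*ʳ (mat a b c d) (mat a′ b′ c′ d′) =
  mat-cong (entry a b a′ c′) (entry a b b′ d′) (entry c d a′ c′) (entry c d b′ d′)
  where
  entry : ∀ a b x y → a ℤ.* (ℤ.- x) ℤ.+ b ℤ.* (ℤ.- y) ≡ ℤ.- (a ℤ.* x ℤ.+ b ℤ.* y)
  entry = solve-∀

-- Also the carrier of PGL₂(ℤ), as a setoid under _≈±_.
record GL₂ℤ : Set where
  constructor [_,_]
  field
    matrix     : Mat₂
    unimodular : Unimodular matrix

open GL₂ℤ

infix  4 _≈±_
infixl 7 _∙_
infix  8 _⁻¹

_≈±_ : GL₂ℤ → GL₂ℤ → Set
A ≈± B = matrix A ≡ matrix B ⊎ matrix A ≡ -ᴹ matrix B

_∙_ : GL₂ℤ → GL₂ℤ → GL₂ℤ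
[ A , p ] ∙ [ B , q ] = [ A *ᴹ B , *ᴹ-unimodular A B p q ]

ε : GL₂ℤ
ε = [ Iᴹ , inj₁ refl ]

-- The adjugate is the inverse times the determinant ±1, hence an inverse
-- modulo ±I.
_⁻¹ : GL₂ℤ → GL₂ℤ
[ A , p ] ⁻¹ = [ adj A , adj-unimodular A p ]

≈±-refl : Reflexive _≈±_
≈±-refl = inj₁ refl

≈±-sym : Symmetric _≈±_
≈±-sym (inj₁ p) = inj₁ (sym p)
≈±-sym {A} {B} (inj₂ p) =
  inj₂ (trans (sym (-ᴹ-involutive (matrix B))) (cong -ᴹ_ (sym p)))

≈±-trans : Transitive _≈±_
≈±-trans (inj₁ p) (inj₁ q) = inj₁ (trans p q)
≈±-trans (inj₁ p) (inj₂ q) = inj₂ (trans p q)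
≈±-trans (inj₂ p) (inj₁ q) = inj₂ (trans p (cong -ᴹ_ q))
≈±-trans (inj₂ p) (inj₂ q) = inj₁ (trans p (trans (cong -ᴹ_ q) (-ᴹ-involutive _)))

∙-cong : ∀ {A A′ B B′} → A ≈± A′ → B ≈± B′ → A ∙ B ≈± A′ ∙ B′
∙-cong (inj₁ p) (inj₁ q) = inj₁ (cong₂ _*ᴹ_ p q)
∙-cong {A′ = A′} {B′ = B′} (inj₁ p) (inj₂ q) =
  inj₂ (trans (cong₂ _*ᴹ_ p q) (-ᴹ-*ʳ (matrix A′) (matrix B′)))
∙-cong {A′ = A′} {B′ = B′} (inj₂ p) (inj₁ q) =
  inj₂ (trans (cong₂ _*ᴹ_ p q) (-ᴹ-*ˡ (matrix A′) (matrix B′)))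
∙-cong {A′ = A′} {B′ = B′} (inj₂ p) (inj₂ q) =
  inj₁ (trans (cong₂ _*ᴹ_ p q)
       (trans (-ᴹ-*ˡ (matrix A′) (-ᴹ matrix B′))
       (trans (cong -ᴹ_ (-ᴹ-*ʳ (matrix A′) (matrix B′)))
              (-ᴹ-involutive _))))

⁻¹-cong : ∀ {A B} → A ≈± B → A ⁻¹ ≈± B ⁻¹
⁻¹-cong (inj₁ p) = inj₁ (cong adj p)
⁻¹-cong (inj₂ p) = inj₂ (cong adj p)

⁻¹-inverseˡ : ∀ A → A ⁻¹ ∙ A ≈± ε
⁻¹-inverseˡ [ A , inj₁ p ] = inj₁ (trans (*ᴹ-adjˡ A) (cong scalar p))
⁻¹-inverseˡ [ A , inj₂ p ] = inj₂ (trans (*ᴹ-adjˡ A) (cong scalar p))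

⁻¹-inverseʳ : ∀ A → A ∙ A ⁻¹ ≈± ε
⁻¹-inverseʳ [ A , inj₁ p ] = inj₁ (trans (*ᴹ-adjʳ A) (cong scalar p))
⁻¹-inverseʳ [ A , inj₂ p ] = inj₂ (trans (*ᴹ-adjʳ A) (cong scalar p))

PGL₂ℤ : Group 0ℓ 0ℓ
PGL₂ℤ = record
  { Carrier = GL₂ℤ
  ; _≈_     = _≈±_
  ; _∙_     = _∙_
  ; ε       = ε
  ; _⁻¹     = _⁻¹
  ; isGroup = record
    { isMonoid = record
      { isSemigroup = record
        { isMagma = record
          { isEquivalence = record
            { refl  = λ {A} → ≈±-refl {A}
            ; sym   = λ {A} {B} → ≈±-sym {A} {B}
            ; trans = λ {A} {B} {C} → ≈±-trans {A} {B} {C}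
            }
          ; ∙-cong = λ {A} {A′} {B} {B′} → ∙-cong {A} {A′} {B} {B′}
          }
        ; assoc = λ A B C → inj₁ (*ᴹ-assoc (matrix A) (matrix B) (matrix C))
        }
      ; identity = (λ A → inj₁ (*ᴹ-identityˡ (matrix A)))
                 , (λ A → inj₁ (*ᴹ-identityʳ (matrix A)))
      }
    ; inverse = ⁻¹-inverseˡ , ⁻¹-inverseʳ
    ; ⁻¹-cong = λ {A} {B} → ⁻¹-cong {A} {B}
    }
  }

-- V : x ↦ - x,  K : x ↦ 1 - x,  U : x ↦ 1 / x
V K U : GL₂ℤ
V = [ mat -1ℤ 0ℤ 0ℤ 1ℤ , inj₂ refl ]
K = [ mat -1ℤ 1ℤ 0ℤ 1ℤ , inj₂ refl ]
U = [ mat 0ℤ 1ℤ 1ℤ 0ℤ , inj₂ refl ]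

-- As V, K and U generate PGL₂(ℤ), at most one α (up to pointwise _≈±_)
-- satisfies this.
record IsDyerAutomorphism (α : GL₂ℤ → GL₂ℤ) : Set where
  open GroupMorphisms (Group.rawGroup PGL₂ℤ) (Group.rawGroup PGL₂ℤ)
  field
    isGroupIsomorphism : IsGroupIsomorphism α
    α-V : α V ≈± U ∙ V
    α-K : α K ≈± K
    α-U : α U ≈± U

{-# OPTIONS --safe #-}

-- Put F(x) = (con x, con (1/x)) and let T : x ↦ 1 + x. The defining equations
-- of con say F(T x) = T* F(x) and F(U x) = U F(x), where T* = (1 1; 1 0)
-- represents α(T). Hence F(M x) = M* F(x) whenever M is a product of T's and
-- U's, with M* a representative of α(M). Every unimodular matrix with
-- nonnegative entries is such a product, by the Euclidean algorithm on its
-- rows, and M* is read off from F(1) = (1, 1) and F(2) = (2, 1).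
module Submission where

open import Defs
open import Algebra.Morphism.Structures using (module GroupMorphisms)
open import Data.Integer.Base as ℤ using (ℤ; +_; 0ℤ; 1ℤ; -1ℤ; _+_; _-_; _*_)
open import Data.Integer.Properties using (+-injective; pos-*; *-comm)
open import Data.Integer.Tactic.RingSolver using (solve-∀)
open import Data.Nat.Base as ℕ using (ℕ; zero; suc)
open import Data.Nat.Properties as ℕ using (≤-<-connex; m≤n⇒m<n∨m≡n; m≤n⇒∃[o]m+o≡n; m+n≡0⇒m≡0; m+n≡0⇒n≡0)
open import Data.Product.Base using (Σ-syntax; ∃; _×_; _,_; proj₁; proj₂; swap)
open import Data.Rational.Base as ℚ using (ℚ; 1ℚ; toℚᵘ)
open import Data.Rational.Properties as ℚ using (toℚᵘ-injective; toℚᵘ-fromℚᵘ; toℚᵘ-homo-+)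
open import Data.Rational.Unnormalised.Base using (mkℚᵘ; *≡*; _≃_)
open import Data.Rational.Unnormalised.Properties using (≃-sym; ≃-trans; +-congʳ)
open import Data.Sum.Base using (_⊎_; inj₁; inj₂)
open import Relation.Binary.PropositionalEquality using (_≡_; refl; sym; trans; cong; cong₂; subst)
open import Relation.Nullary using (¬_; contradiction)

open GL₂ℤ using (matrix; unimodular)

-- Arithmetic of positive fractions.

ℕ⁺-≡ : ∀ {m n} → toℤ m ≡ toℤ n → m ≡ n
ℕ⁺-≡ {mkℕ⁺ m} {mkℕ⁺ n} e with refl ← +-injective e = refl

ℚ⁺-≡ : ∀ {x y} → ℚ⁺.value x ≡ ℚ⁺.value y → x ≡ y
ℚ⁺-≡ {mkℚ⁺ x} {mkℚ⁺ y} refl = refl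

1+[m/n]≡[n+m]/n : ∀ m n → 1ℚ⁺ +ℚ⁺ (m /⁺ n) ≡ (n +ℕ⁺ m) /⁺ n
1+[m/n]≡[n+m]/n (mkℕ⁺ m) (mkℕ⁺ n@(suc n-1)) = ℚ⁺-≡ (toℚᵘ-injective
  (≃-trans (toℚᵘ-homo-+ 1ℚ (+ m ℚ./ n))
  (≃-trans (+-congʳ (toℚᵘ 1ℚ) (toℚᵘ-fromℚᵘ (mkℚᵘ (+ m) n-1)))
  (≃-trans (*≡* (cross (+ m) (+ n)))
           (≃-sym (toℚᵘ-fromℚᵘ (mkℚᵘ (+ (n ℕ.+ m)) n-1)))))))
  where
  cross : ∀ m n → (1ℤ * n + m * 1ℤ) * n ≡ (n + m) * (1ℤ * n)
  cross = solve-∀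

-- `ℚ.1/` computes only once the numerator of `x` is exposed, and `+ m ℚ./ n` hides it behind a gcd;
-- hence a general `x`. Inversion merely rearranges the cross-multiplied equation.
1/-≃ : ∀ (x : ℚ) .{{_ : ℚ.NonZero x}} {m n} → toℚᵘ x ≃ mkℚᵘ (+ suc m) n →
       toℚᵘ (ℚ.1/ x) ≃ mkℚᵘ (+ suc n) m
1/-≃ (ℚ.mkℚ (+ suc a) d _) {m} {n} (*≡* e) = *≡*
  (trans (*-comm (+ suc d) (+ suc m)) (trans (sym e) (*-comm (+ suc a) (+ suc n))))
1/-≃ (ℚ.mkℚ (+ zero)  _ _) (*≡* ())
1/-≃ (ℚ.mkℚ ℤ.-[1+ _ ] _ _) (*≡* ())

1/[m/n]≡n/m : ∀ m n → 1/⁺ (m /⁺ n) ≡ n /⁺ m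
1/[m/n]≡n/m (mkℕ⁺ m@(suc m-1)) (mkℕ⁺ n@(suc n-1)) = ℚ⁺-≡ (toℚᵘ-injective
  (≃-trans (1/-≃ (+ m ℚ./ n) {{ℚ.pos⇒nonZero (+ m ℚ./ n) {{ℚ.normalize-pos m n}}}} (toℚᵘ-fromℚᵘ (mkℚᵘ (+ m) n-1)))
           (≃-sym (toℚᵘ-fromℚᵘ (mkℚᵘ (+ n) m-1)))))

-- Words in `T` and `U` acting on vectors and on fractions.

infixr 7 _·_

_·_ : Mat₂ → ℤ × ℤ → ℤ × ℤ
mat a b c d · (x , y) = a * x + b * y , c * x + d * y

·-identity : ∀ v → Iᴹ · v ≡ v
·-identity (x , y) = cong₂ _,_ (top x y) (bottom x y)
  where
  top : ∀ x y → 1ℤ * x + 0ℤ * y ≡ x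
  top = solve-∀
  bottom : ∀ x y → 0ℤ * x + 1ℤ * y ≡ y
  bottom = solve-∀

·-assoc : ∀ A B v → (A *ᴹ B) · v ≡ A · B · v
·-assoc (mat a b c d) (mat a′ b′ c′ d′) (x , y) =
  cong₂ _,_ (entry a b a′ b′ c′ d′ x y) (entry c d a′ b′ c′ d′ x y)
  where
  entry : ∀ a b a′ b′ c′ d′ x y →
    (a * a′ + b * c′) * x + (a * b′ + b * d′) * y ≡
    a * (a′ * x + b′ * y) + b * (c′ * x + d′ * y)
  entry = solve-∀

T T* : GL₂ℤ
T  = [ mat 1ℤ 1ℤ 0ℤ 1ℤ , inj₁ refl ]
T* = [ mat 1ℤ 1ℤ 1ℤ 0ℤ , inj₂ refl ]

data Word : Set where
  []         : Word
  shift flip : Word → Word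

-- The letter `S` is a parameter so that the same word gives both M (`S = T`) and M* (`S = T*`).
eval : GL₂ℤ → Word → GL₂ℤ
eval S []        = ε
eval S (shift w) = S ∙ eval S w
eval S (flip w)  = U ∙ eval S w

-- A pair (m , n) stands for the fraction m / n.
shift² : ℕ⁺ × ℕ⁺ → ℕ⁺ × ℕ⁺
shift² (m , n) = n +ℕ⁺ m , n

run : Word → ℕ⁺ × ℕ⁺ → ℕ⁺ × ℕ⁺
run []        x = x
run (shift w) x = shift² (run w x)
run (flip w)  x = swap (run w x)

-- One induction serves both the fractions themselves (`T` with `toℤ²`) and their conumerators (`T*`
-- with `con²`).
run-equivariant : ∀ S (f : ℕ⁺ × ℕ⁺ → ℤ × ℤ) →
  (∀ x → f (shift² x) ≡ matrix S · f x) → (∀ x → f (swap x) ≡ matrix U · f x) →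
  ∀ w x → f (run w x) ≡ matrix (eval S w) · f x
run-equivariant S f f-shift f-swap = go
  where
  go : ∀ w x → f (run w x) ≡ matrix (eval S w) · f x
  go []        x = sym (·-identity (f x))
  go (shift w) x = trans (f-shift (run w x))
    (trans (cong (matrix S ·_) (go w x)) (sym (·-assoc (matrix S) (matrix (eval S w)) (f x))))
  go (flip w)  x = trans (f-swap (run w x))
    (trans (cong (matrix U ·_) (go w x)) (sym (·-assoc (matrix U) (matrix (eval S w)) (f x))))

U-swaps : ∀ x y → (y , x) ≡ matrix U · (x , y)
U-swaps x y = cong₂ _,_ (top x y) (bottom x y)
  where
  top : ∀ x y → y ≡ 0ℤ * x + 1ℤ * y
  top = solve-∀
  bottom : ∀ x y → x ≡ 1ℤ * x + 0ℤ * y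
  bottom = solve-∀

toℤ² : ℕ⁺ × ℕ⁺ → ℤ × ℤ
toℤ² (m , n) = toℤ m , toℤ n

toℤ²-injective : ∀ {x y} → toℤ² x ≡ toℤ² y → x ≡ y
toℤ²-injective e = cong₂ _,_ (ℕ⁺-≡ (cong proj₁ e)) (ℕ⁺-≡ (cong proj₂ e))

toℤ²-run : ∀ w x → toℤ² (run w x) ≡ matrix (eval T w) · toℤ² x
toℤ²-run = run-equivariant T toℤ²
  (λ (m , n) → cong₂ _,_ (top (toℤ m) (toℤ n)) (bottom (toℤ m) (toℤ n)))
  (λ (m , n) → U-swaps (toℤ m) (toℤ n))
  where
  top : ∀ m n → n + m ≡ 1ℤ * m + 1ℤ * n
  top = solve-∀
  bottom : ∀ m n → n ≡ 0ℤ * m + 1ℤ * n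
  bottom = solve-∀

-- Conumerators along a word.

module _ {con : ℚ⁺ → ℕ⁺} (isConumerator : IsConumerator con) where
  open IsConumerator isConumerator

  con² : ℕ⁺ × ℕ⁺ → ℤ × ℤ
  con² (m , n) = toℤ (con (m /⁺ n)) , toℤ (con (n /⁺ m))

  con²-shift² : ∀ x → con² (shift² x) ≡ matrix T* · con² x
  con²-shift² (m , n) = cong₂ _,_ (trans (cong toℤ con-[n+m]/n) (top (toℤ (con (m /⁺ n))) (toℤ (con (n /⁺ m)))))
                                  (trans (cong toℤ con-n/[n+m]) (bottom (toℤ (con (m /⁺ n))) (toℤ (con (n /⁺ m)))))
    where
    con-[n+m]/n : con ((n +ℕ⁺ m) /⁺ n) ≡ con (m /⁺ n) +ℕ⁺ con (n /⁺ m)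
    con-[n+m]/n = trans (cong con (sym (1+[m/n]≡[n+m]/n m n)))
      (trans (con-1+x (m /⁺ n)) (cong (λ y → con (m /⁺ n) +ℕ⁺ con y) (1/[m/n]≡n/m m n)))
    con-n/[n+m] : con (n /⁺ (n +ℕ⁺ m)) ≡ con (m /⁺ n)
    con-n/[n+m] = trans (cong con (trans (sym (1/[m/n]≡n/m (n +ℕ⁺ m) n))
                                         (cong 1/⁺_ (sym (1+[m/n]≡[n+m]/n m n)))))
      (con-1/[1+x] (m /⁺ n))
    top : ∀ x y → x + y ≡ 1ℤ * x + 1ℤ * y
    top = solve-∀
    bottom : ∀ x y → x ≡ 1ℤ * x + 0ℤ * y
    bottom = solve-∀

  con²-run : ∀ w x → con² (run w x) ≡ matrix (eval T* w) · con² x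
  con²-run = run-equivariant T* con² con²-shift²
    -- Exchanging `m` and `n` exchanges the two coordinates of `con²` by definition.
    (λ (m , n) → U-swaps (toℤ (con (m /⁺ n))) (toℤ (con (n /⁺ m))))

  con²-1 : con² (1ℕ⁺ , 1ℕ⁺) ≡ (+ 1 , + 1)
  con²-1 = cong₂ _,_ (cong toℤ con-1) (cong toℤ con-1)

  con²-2 : con² (2ℕ⁺ , 1ℕ⁺) ≡ (+ 2 , + 1)
  con²-2 = trans (con²-shift² (1ℕ⁺ , 1ℕ⁺)) (cong (matrix T* ·_) con²-1)

-- Dyer's automorphism along a word.

module _ {α : GL₂ℤ → GL₂ℤ} (isDyer : IsDyerAutomorphism α) where
  open IsDyerAutomorphism isDyer
  open GroupMorphisms.IsGroupIsomorphism isGroupIsomorphism using (⟦⟧-cong; ∙-homo; ε-homo)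

  -- T = K V, and K (U V) is the negative of T*.
  α-T : α T ≈± T*
  α-T = ≈±-trans {α T} {α K ∙ α V} {T*} (∙-homo K V)
       (≈±-trans {α K ∙ α V} {K ∙ (U ∙ V)} {T*}
         (∙-cong {α K} {K} {α V} {U ∙ V} α-K α-V) (inj₂ refl))

  α-eval : ∀ w → α (eval T w) ≈± eval T* w
  α-eval []        = ε-homo
  α-eval (shift w) = ≈±-trans {α (T ∙ eval T w)} {α T ∙ α (eval T w)} {T* ∙ eval T* w}
    (∙-homo T (eval T w)) (∙-cong {α T} {T*} {α (eval T w)} {eval T* w} α-T (α-eval w))
  α-eval (flip w)  = ≈±-trans {α (U ∙ eval T w)} {α U ∙ α (eval T w)} {U ∙ eval T* w}
    (∙-homo U (eval T w)) (∙-cong {α U} {U} {α (eval T w)} {eval T* w} α-U (α-eval w))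

  -- The unimodularity of `N` is inherited from `eval T* w`, so it needs no determinant computation.
  α-word : ∀ w {M N} → matrix (eval T w) ≡ matrix M → matrix (eval T* w) ≡ N →
           Σ[ v ∈ Unimodular N ] α M ≈± [ N , v ]
  α-word w {M} w≡M refl = unimodular (eval T* w) ,
    ≈±-trans {α M} {α (eval T w)} {eval T* w} (⟦⟧-cong (inj₁ (sym w≡M))) (α-eval w)

-- Factoring nonnegative unimodular matrices into words.

matℕ : ℕ → ℕ → ℕ → ℕ → Mat₂
matℕ p q r s = mat (+ p) (+ q) (+ r) (+ s)

-- Exact equality, not equality up to sign, so that the word sends pairs of positive integers where
-- the matrix does.
Word-for : Mat₂ → Set
Word-for A = ∃ λ w → matrix (eval T w) ≡ A

U-swaps-rows : ∀ p q r s → matrix U *ᴹ mat p q r s ≡ mat r s p q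
U-swaps-rows p q r s = mat-cong (top p r) (top q s) (bottom p r) (bottom q s)
  where
  top : ∀ x y → 0ℤ * x + 1ℤ * y ≡ y
  top = solve-∀
  bottom : ∀ x y → 1ℤ * x + 0ℤ * y ≡ x
  bottom = solve-∀

unimodular-flip : ∀ p q r s → Unimodular (mat p q r s) → Unimodular (mat r s p q)
unimodular-flip p q r s u =
  subst Unimodular (U-swaps-rows p q r s)
    (*ᴹ-unimodular (matrix U) (mat p q r s) (unimodular U) u)

word-flip : ∀ {p q r s} → Word-for (mat p q r s) → Word-for (mat r s p q)
word-flip {p} {q} {r} {s} (w , refl) = flip w , U-swaps-rows p q r s

word-shift : ∀ {p q r s} → Word-for (mat p q r s) → Word-for (mat (r + p) (s + q) r s)
word-shift {p} {q} {r} {s} (w , refl) =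
  shift w , mat-cong (top p r) (top q s) (bottom p r) (bottom q s)
  where
  top : ∀ x y → 1ℤ * x + 1ℤ * y ≡ y + x
  top = solve-∀
  bottom : ∀ x y → 0ℤ * x + 1ℤ * y ≡ y
  bottom = solve-∀

unimodular-unshift : ∀ p q r s → Unimodular (mat (r + p) (s + q) r s) → Unimodular (mat p q r s)
unimodular-unshift p q r s = subst (λ k → k ≡ 1ℤ ⊎ k ≡ -1ℤ) (lemma p q r s)
  where
  lemma : ∀ p q r s → (r + p) * s - (s + q) * r ≡ p * s - q * r
  lemma = solve-∀

-- Rules out subtracting a zero row, which would not lower the sum of the entries.
singular-zero-row : ∀ p q → ¬ Unimodular (matℕ p q 0 0)
singular-zero-row p q =
  subst (λ k → ¬ (k ≡ 1ℤ ⊎ k ≡ -1ℤ)) (sym (lemma (+ p) (+ q))) λ { (inj₁ ()) ; (inj₂ ()) }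
  where
  lemma : ∀ p q → p * 0ℤ - q * 0ℤ ≡ 0ℤ
  lemma = solve-∀

-- Here the determinant is 1 + (r + i + q + j + …) with nonnegative terms.
word-dominant-diagonal : ∀ p q r s → r ℕ.< p → q ℕ.< s →
                         Unimodular (matℕ p q r s) → Word-for (matℕ p q r s)
word-dominant-diagonal p q r s r<p q<s u
  with i , refl ← m≤n⇒∃[o]m+o≡n r<p | j , refl ← m≤n⇒∃[o]m+o≡n q<s
  = go (subst (λ k → k ≡ 1ℤ ⊎ k ≡ -1ℤ) det-expansion u)
  where
  rest : ℕ
  rest = r ℕ.* j ℕ.+ i ℕ.* q ℕ.+ i ℕ.* j

  identity : ∀ q r i j → (1ℤ + (r + i)) * (1ℤ + (q + j)) - q * r ≡
                         1ℤ + (r + i + (q + j) + (r * j + i * q + i * j))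
  identity = solve-∀

  det-expansion : det (matℕ (suc r ℕ.+ i) q r (suc q ℕ.+ j)) ≡ + suc (r ℕ.+ i ℕ.+ (q ℕ.+ j) ℕ.+ rest)
  det-expansion = trans (identity (+ q) (+ r) (+ i) (+ j))
    (cong (λ k → 1ℤ + (+ (r ℕ.+ i ℕ.+ (q ℕ.+ j)) + k))
      (sym (cong₂ _+_ (cong₂ _+_ (pos-* r j) (pos-* i q)) (pos-* i j))))

  go : + suc (r ℕ.+ i ℕ.+ (q ℕ.+ j) ℕ.+ rest) ≡ 1ℤ ⊎ + suc (r ℕ.+ i ℕ.+ (q ℕ.+ j) ℕ.+ rest) ≡ -1ℤ →
       Word-for (matℕ (suc r ℕ.+ i) q r (suc q ℕ.+ j))
  -- Determinant 1 makes `r`, `i`, `q` and `j` vanish, leaving the identity matrix and the empty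
  -- word. A positive determinant is never -1, so the other case is empty.
  go (inj₁ e) = [] , sym (mat-cong (cong₂ (λ r i → + suc (r ℕ.+ i)) r≡0 i≡0) (cong +_ q≡0)
                                   (cong +_ r≡0) (cong₂ (λ q j → + suc (q ℕ.+ j)) q≡0 j≡0))
    where
    r+i+[q+j]≡0 : r ℕ.+ i ℕ.+ (q ℕ.+ j) ≡ 0
    r+i+[q+j]≡0 = m+n≡0⇒m≡0 _ (ℕ.suc-injective (+-injective e))
    r≡0 = m+n≡0⇒m≡0 r (m+n≡0⇒m≡0 (r ℕ.+ i) r+i+[q+j]≡0)
    i≡0 = m+n≡0⇒n≡0 r (m+n≡0⇒m≡0 (r ℕ.+ i) r+i+[q+j]≡0)
    q≡0 = m+n≡0⇒m≡0 q (m+n≡0⇒n≡0 (r ℕ.+ i) r+i+[q+j]≡0)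
    j≡0 = m+n≡0⇒n≡0 q (m+n≡0⇒n≡0 (r ℕ.+ i) r+i+[q+j]≡0)

-- Induction on the sum of the entries. If one row dominates the other entrywise, subtracting the
-- smaller strips off a `T`, after a flip if needed. If the rows cross strictly in both columns,
-- only the identity and `U` are possible.
nonnegative-word : ∀ p q r s → Unimodular (matℕ p q r s) → Word-for (matℕ p q r s)
nonnegative-word p q r s = go _ p q r s ℕ.≤-refl
  where
  Below : ℕ → Set
  Below n = ∀ p q r s → p ℕ.+ q ℕ.+ (r ℕ.+ s) ℕ.< n →
            Unimodular (matℕ p q r s) → Word-for (matℕ p q r s)

  -- The split on `r` and `s` locates a positive entry in the subtracted row; its column makes the
  -- sum of the entries drop strictly.
  subtract-row : ∀ {n} → Below n → ∀ p q r s → r ℕ.≤ p → s ℕ.≤ q → p ℕ.+ q ℕ.+ (r ℕ.+ s) ℕ.< suc n →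
                 Unimodular (matℕ p q r s) → Word-for (matℕ p q r s)
  subtract-row rec p q zero zero _ _ _ u = contradiction u (singular-zero-row p q)
  subtract-row rec p q r@(suc _) s r≤p s≤q lt u
    with p′ , refl ← m≤n⇒∃[o]m+o≡n r≤p | q′ , refl ← m≤n⇒∃[o]m+o≡n s≤q =
    word-shift (rec p′ q′ r s
      (ℕ.<-≤-trans (ℕ.+-monoˡ-< (r ℕ.+ s)
                     (ℕ.+-mono-<-≤ (ℕ.m<n+m p′ {r} (ℕ.s≤s ℕ.z≤n)) (ℕ.m≤n+m q′ s)))
                   (ℕ.≤-pred lt))
      (unimodular-unshift (+ p′) (+ q′) (+ r) (+ s) u))
  subtract-row rec p q zero s@(suc _) r≤p s≤q lt u
    with q′ , refl ← m≤n⇒∃[o]m+o≡n s≤q =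
    word-shift (rec p q′ 0 s
      (ℕ.<-≤-trans (ℕ.+-monoˡ-< s (ℕ.+-monoʳ-< p (ℕ.m<n+m q′ {s} (ℕ.s≤s ℕ.z≤n))))
                   (ℕ.≤-pred lt))
      (unimodular-unshift (+ p) (+ q′) (+ 0) (+ s) u))

  go : ∀ n → Below n
  go (suc n) p q r s lt u = cases (≤-<-connex r p) (≤-<-connex s q)
    where
    u′ : Unimodular (matℕ r s p q)
    u′ = unimodular-flip (+ p) (+ q) (+ r) (+ s) u

    flipped : p ℕ.≤ r → q ℕ.≤ s → Word-for (matℕ p q r s)
    flipped p≤r q≤s = word-flip (subtract-row (go n) r s p q p≤r q≤s
      (subst (ℕ._< suc n) (ℕ.+-comm (p ℕ.+ q) (r ℕ.+ s)) lt) u′)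

    cases : r ℕ.≤ p ⊎ p ℕ.< r → s ℕ.≤ q ⊎ q ℕ.< s → Word-for (matℕ p q r s)
    cases (inj₁ r≤p) (inj₁ s≤q) = subtract-row (go n) p q r s r≤p s≤q lt u
    cases (inj₂ p<r) (inj₂ q<s) = flipped (ℕ.<⇒≤ p<r) (ℕ.<⇒≤ q<s)
    -- A tie in the first column means that the lower row dominates after all.
    cases (inj₁ r≤p) (inj₂ q<s) with m≤n⇒m<n∨m≡n r≤p
    ... | inj₁ r<p = word-dominant-diagonal p q r s r<p q<s u
    ... | inj₂ r≡p = flipped (ℕ.≤-reflexive (sym r≡p)) (ℕ.<⇒≤ q<s)
    cases (inj₂ p<r) (inj₁ s≤q) with m≤n⇒m<n∨m≡n s≤q
    ... | inj₁ s<q = word-flip (word-dominant-diagonal r s p q p<r s<q u′)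
    ... | inj₂ s≡q = flipped (ℕ.<⇒≤ p<r) (ℕ.≤-reflexive (sym s≡q))

-- Recovering M* from its values, and the formula.

-- The columns are the images of (1,0) = (2,1) - (1,1) and (0,1) = 2(1,1) - (2,1).
values-determine-matrix : ∀ A {a b c d} → A · (+ 2 , + 1) ≡ (a , c) → A · (+ 1 , + 1) ≡ (b , d) →
                          A ≡ mat (a - b) (+ 2 * b - a) (c - d) (+ 2 * d - c)
values-determine-matrix (mat e f g h) refl refl = mat-cong (left e f) (right e f) (left g h) (right g h)
  where
  left : ∀ x y → x ≡ (x * + 2 + y * 1ℤ) - (x * 1ℤ + y * 1ℤ)
  left = solve-∀
  right : ∀ x y → y ≡ + 2 * (x * 1ℤ + y * 1ℤ) - (x * + 2 + y * 1ℤ)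
  right = solve-∀

lemma5 : (con : ℚ⁺ → ℕ⁺) → IsConumerator con →
         (α : GL₂ℤ → GL₂ℤ) → IsDyerAutomorphism α →
         (p q r s : ℕ⁺) →
         (u : Unimodular (mat (toℤ p) (toℤ q) (toℤ r) (toℤ s))) →
         let a = toℤ (con ((2ℕ⁺ *ℕ⁺ p +ℕ⁺ q) /⁺ (2ℕ⁺ *ℕ⁺ r +ℕ⁺ s)))
             b = toℤ (con ((p +ℕ⁺ q) /⁺ (r +ℕ⁺ s)))
             c = toℤ (con ((2ℕ⁺ *ℕ⁺ r +ℕ⁺ s) /⁺ (2ℕ⁺ *ℕ⁺ p +ℕ⁺ q)))
             d = toℤ (con ((r +ℕ⁺ s) /⁺ (p +ℕ⁺ q)))
             N = mat (a - b) (+ 2 * b - a)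
                     (c - d) (+ 2 * d - c)
         in Σ[ v ∈ Unimodular N ] α [ mat (toℤ p) (toℤ q) (toℤ r) (toℤ s) , u ] ≈± [ N , v ]
lemma5 con isCon α isDyer p q r s u =
  α-word isDyer w w≡M (values-determine-matrix (matrix M*) M*-2 M*-1)
  where
  M : Mat₂
  M = mat (toℤ p) (toℤ q) (toℤ r) (toℤ s)

  M-word : Word-for M
  M-word = nonnegative-word (ℕ⁺.value p) (ℕ⁺.value q) (ℕ⁺.value r) (ℕ⁺.value s) u

  w : Word
  w = proj₁ M-word

  w≡M : matrix (eval T w) ≡ M
  w≡M = proj₂ M-word

  M* : GL₂ℤ
  M* = eval T* w

  at-1 : ∀ x y → x * 1ℤ + y * 1ℤ ≡ x + y
  at-1 = solve-∀
  -- `x + (x + 0ℤ)` is the form to which the product by 2 in `2ℕ⁺ *ℕ⁺ p` unfolds.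
  at-2 : ∀ x y → x * + 2 + y * 1ℤ ≡ x + (x + 0ℤ) + y
  at-2 = solve-∀

  run-1 : run w (1ℕ⁺ , 1ℕ⁺) ≡ (p +ℕ⁺ q , r +ℕ⁺ s)
  run-1 = toℤ²-injective (trans (toℤ²-run w (1ℕ⁺ , 1ℕ⁺)) (trans (cong (_· (1ℤ , 1ℤ)) w≡M)
    (cong₂ _,_ (at-1 (toℤ p) (toℤ q)) (at-1 (toℤ r) (toℤ s)))))

  run-2 : run w (2ℕ⁺ , 1ℕ⁺) ≡ (2ℕ⁺ *ℕ⁺ p +ℕ⁺ q , 2ℕ⁺ *ℕ⁺ r +ℕ⁺ s)
  run-2 = toℤ²-injective (trans (toℤ²-run w (2ℕ⁺ , 1ℕ⁺)) (trans (cong (_· (+ 2 , 1ℤ)) w≡M)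
    (cong₂ _,_ (at-2 (toℤ p) (toℤ q)) (at-2 (toℤ r) (toℤ s)))))

  -- Both sides are `con²` of `run w (2ℕ⁺ , 1ℕ⁺)`: the left by equivariance, the right by `run-2`.
  M*-2 : matrix M* · (+ 2 , 1ℤ) ≡ con² isCon (2ℕ⁺ *ℕ⁺ p +ℕ⁺ q , 2ℕ⁺ *ℕ⁺ r +ℕ⁺ s)
  M*-2 = trans (sym (trans (con²-run isCon w (2ℕ⁺ , 1ℕ⁺)) (cong (matrix M* ·_) (con²-2 isCon))))
               (cong (con² isCon) run-2)

  M*-1 : matrix M* · (1ℤ , 1ℤ) ≡ con² isCon (p +ℕ⁺ q , r +ℕ⁺ s)
  M*-1 = trans (sym (trans (con²-run isCon w (1ℕ⁺ , 1ℕ⁺)) (cong (matrix M* ·_) (con²-1 isCon))))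
               (cong (con² isCon) run-1)
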